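{- For every $j\in\mathbb{N}$ there exists an (effectively computable) integer $n_\Delta(j)$ such that for all integers $n\ge n_\Delta(j)$, \[ \Delta^{[2]}_j(u)(n):=u(n)-2u(n-j)+u(n-2j)>0. \]
   Context: $u(n)$ denotes the number of unimodal sequences of size $n$, i.e. the number of sequences of positive integers $a_1\le\dots\le a_r\le c\ge b_s\ge\dots\ge b_1$ ($r,s\ge0$) summing to $n$; equivalently $\sum_{n\ge0}u(n)q^n=\sum_{n\ge0}\frac{q^n}{(q;q)_n^2}$ with $(a;q)_n=\prod_{j=0}^{n-1}(1-aq^j)$. -}

module Defs where

open import Data.Integer.Base as ℤ using (ℤ; +_; -[1+_])
open import Data.List.Base using (List; []; _∷_; _++_; length; upTo; filter; cartesianProduct; cartesianProductWith)
open import Data.List.Membership.Propositional using (_∈_)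
open import Data.List.Membership.Propositional.Properties using (∈-cartesianProductWith⁺; ∈-cartesianProductWith⁻; ∈-cartesianProduct⁺; ∈-filter⁺; ∈-filter⁻; ∈-upTo⁺)
open import Data.List.Properties using (∷-injective)
open import Data.List.Relation.Unary.All as All using (All; []; _∷_)
import Data.List.Relation.Unary.All.Properties as Allₚ
open import Data.List.Relation.Unary.AllPairs using ([]; _∷_)
open import Data.List.Relation.Unary.Any using (here; there)
open import Data.List.Relation.Unary.Linked using (Linked; linked?)
open import Data.List.Relation.Unary.Unique.Propositional using (Unique)
import Data.List.Relation.Unary.Unique.Propositional.Properties as Uniqueₚ
open import Data.Nat.Base using (ℕ; zero; suc; _+_; _*_; _≤_; _≥_; s≤s)
open import Data.Nat.Properties using (_≟_; _≤?_; _≥?_; ≤-trans; ≤-reflexive; m≤m+n; m≤n+m)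
open import Data.Nat.ListAction using (sum)
open import Data.Nat.ListAction.Properties using (sum-++)
open import Data.Product.Base using (_×_; _,_; proj₂)
open import Function.Bundles using (_⇔_; mk⇔)
open import Relation.Binary.PropositionalEquality using (_≡_; _≢_; refl; subst)
open import Relation.Nullary.Decidable using (Dec; _×-dec_)

-- (a₁ … a_r , c , b_s … b₁).  The peak c is a component of its own, so
-- sequences differing only in which maximal entry is the peak are distinct;
-- this is what the generating function Σ qⁿ/(q;q)ₙ² counts.
MarkedSeq : Set
MarkedSeq = List ℕ × ℕ × List ℕ

IsUnimodal : ℕ → MarkedSeq → Set
IsUnimodal n (as , c , bs) =
    All (1 ≤_) (as ++ c ∷ bs)
  × Linked _≤_ (as ++ c ∷ [])
  × Linked _≥_ (c ∷ bs)
  × sum (as ++ c ∷ bs) ≡ n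

isUnimodal? : ∀ n s → Dec (IsUnimodal n s)
isUnimodal? n (as , c , bs) =
  All.all? (1 ≤?_) (as ++ c ∷ bs)
  ×-dec linked? _≤?_ (as ++ c ∷ [])
  ×-dec linked? _≥?_ (c ∷ bs)
  ×-dec (sum (as ++ c ∷ bs) ≟ n)

-- All lists of length at most k with entries at most n.
lists : ℕ → ℕ → List (List ℕ)
lists n zero    = [] ∷ []
lists n (suc k) = [] ∷ cartesianProductWith _∷_ (upTo (suc n)) (lists n k)

candidates : ℕ → List MarkedSeq
candidates n = cartesianProduct (lists n n) (cartesianProduct (upTo (suc n)) (lists n n))

unimodals : ℕ → List MarkedSeq
unimodals n = filter (isUnimodal? n) (candidates n)

-- u(0) = 1 is the n = 0 term of the generating function (the empty sequence,
-- which has no peak).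
u : ℕ → ℕ
u zero      = 1
u n@(suc _) = length (unimodals n)

uℤ : ℤ → ℤ
uℤ (+ n)    = + u n
uℤ -[1+ _ ] = + 0

Δ²[_] : ℕ → (ℤ → ℤ) → ℤ → ℤ
Δ²[ j ] f n = f n ℤ.- + 2 ℤ.* f (n ℤ.- + j) ℤ.+ f (n ℤ.- + (2 * j))

-- The list `unimodals n` contains each unimodal sequence of size n exactly
-- once (unimodals-unique and ∈-unimodals), so its length is their number.

private
  lists-unique : ∀ n k → Unique (lists n k)
  lists-unique n zero    = [] ∷ []
  lists-unique n (suc k) =
    All.tabulate (λ x∈ → []∉ (upTo (suc n)) x∈) ∷
    Uniqueₚ.cartesianProductWith⁺ _∷_ ∷-injective (Uniqueₚ.upTo⁺ (suc n)) (lists-unique n k)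
    where
    []∉ : ∀ xs {ys : List ℕ} → ys ∈ cartesianProductWith _∷_ xs (lists n k) → [] ≢ ys
    []∉ xs ys∈ refl with ∈-cartesianProductWith⁻ _∷_ xs (lists n k) ys∈
    ... | _ , _ , _ , _ , ()

  ∈-lists : ∀ n k {xs} → All (1 ≤_) xs → sum xs ≤ n → sum xs ≤ k → xs ∈ lists n k
  ∈-lists n zero    []              _  _  = here refl
  ∈-lists n zero    (s≤s _ ∷ _)     _  ()
  ∈-lists n (suc k) []              _  _  = here refl
  ∈-lists n (suc k) {suc x ∷ xs} (_ ∷ ps) ≤n (s≤s ≤k) =
    there (∈-cartesianProductWith⁺ _∷_
      (∈-upTo⁺ (s≤s (≤-trans (m≤m+n (suc x) (sum xs)) ≤n)))
      (∈-lists n k ps (≤-trans (m≤n+m (sum xs) (suc x)) ≤n) (≤-trans (m≤n+m (sum xs) x) ≤k)))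

  ∈-candidates : ∀ n s → IsUnimodal n s → s ∈ candidates n
  ∈-candidates n (as , c , bs) (pos , _ , _ , size) with Allₚ.++⁻ as pos
  ... | pas , _ ∷ pbs =
    ∈-cartesianProduct⁺ (∈-lists n n pas as≤ as≤)
      (∈-cartesianProduct⁺ (∈-upTo⁺ (s≤s c≤)) (∈-lists n n pbs bs≤ bs≤))
    where
    total : sum as + (c + sum bs) ≡ n
    total = subst (_≡ n) (sum-++ as (c ∷ bs)) size
    as≤ : sum as ≤ n
    as≤ = ≤-trans (m≤m+n (sum as) (c + sum bs)) (≤-reflexive total)
    rest≤ : c + sum bs ≤ n
    rest≤ = ≤-trans (m≤n+m (c + sum bs) (sum as)) (≤-reflexive total)
    c≤ : c ≤ n
    c≤ = ≤-trans (m≤m+n c (sum bs)) rest≤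
    bs≤ : sum bs ≤ n
    bs≤ = ≤-trans (m≤n+m (sum bs) c) rest≤

unimodals-unique : ∀ n → Unique (unimodals n)
unimodals-unique n = Uniqueₚ.filter⁺ (isUnimodal? n)
  (Uniqueₚ.cartesianProduct⁺ (lists-unique n n)
    (Uniqueₚ.cartesianProduct⁺ (Uniqueₚ.upTo⁺ (suc n)) (lists-unique n n)))

∈-unimodals : ∀ n s → s ∈ unimodals n ⇔ IsUnimodal n s
∈-unimodals n s = mk⇔
  (λ s∈ → proj₂ (∈-filter⁻ (isUnimodal? n) {xs = candidates n} s∈))
  (λ p → ∈-filter⁺ (isUnimodal? n) (∈-candidates n s p) p)

{-# OPTIONS --safe #-}
-- For n > 2j we exhibit a map from U(n) ⊎ U(n - 2j) onto two copies of U(n - j)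
-- and one extra point, where U(m) is the set of unimodal sequences of size m.
-- Write c for the peak and α, β for the entries on its left and right.
-- If c ≥ j, inserting j into α covers one copy; the other is covered by deleting
-- j from α when possible (landing in U(n - 2j)), and by inserting j into β otherwise.
-- If c < j, put j ones in front of α for one copy, and raise the peak to c + j
-- for the other: no entry of α or β equals j then, so this does not collide with
-- the case c ≥ j.  The one-term sequence n is not needed for any of this, since
-- c + j < 2j < n in the last case; it makes the inequality strict, with
-- nΔ(j) = 2j + 1.
module Submission where

open import Defs
open import Data.Integer.Base using (ℤ; 0ℤ; _≤_; _>_)
open import Data.Nat.Base as ℕ using (ℕ)
open import Data.Product.Base using (Σ-syntax)

import Data.Integer.Base as ℤ
import Data.Nat.Properties as ℕₚ
import Data.Integer.Properties as ℤₚ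
open import Data.List.Base using (List; []; _∷_; _++_; [_]; map; length; replicate; drop)
open import Data.List.Membership.DecPropositional ℕₚ._≟_ using (_∈?_)
open import Data.List.Membership.Propositional using (_∈_; _∉_)
open import Data.List.Membership.Propositional.Properties
  using (∈-∃++; ∈-++⁺ˡ; ∈-++⁺ʳ; ∈-++⁻; ∈-map⁺; ∈-map⁻)
open import Data.List.Properties using (length-++; length-map)
import Data.List.Relation.Binary.Pointwise as Pointwise
open import Data.List.Relation.Binary.Permutation.Propositional
  using (_↭_; ↭-refl; ↭-sym; ↭-trans; ↭⇒↭ₛ; prep; swap)
open import Data.List.Relation.Binary.Permutation.Propositional.Properties
  using (All-resp-↭; ∈-resp-↭; drop-∷)
open import Data.List.Relation.Unary.All as All using (All; []; _∷_)
import Data.List.Relation.Unary.All.Properties as Allₚ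
open import Data.List.Relation.Unary.AllPairs using (AllPairs; []; _∷_)
import Data.List.Relation.Unary.AllPairs.Properties as AllPairsₚ
open import Data.List.Relation.Unary.Any using (here; there)
open import Data.List.Relation.Unary.Linked.Properties using (Linked⇒AllPairs; AllPairs⇒Linked)
open import Data.List.Relation.Unary.Sorted.TotalOrder.Properties using (↗↭↗⇒≋)
open import Data.List.Relation.Unary.Unique.Propositional using (Unique)
import Data.List.Relation.Unary.Unique.Propositional.Properties as Uniqueₚ
import Data.List.Sort.InsertionSort.Base as InsertionSort
import Data.List.Sort.InsertionSort.Properties as InsertionSortₚ
open import Data.Maybe.Base using (Maybe; just; nothing)
open import Data.Maybe.Properties using (just-injective)
open import Data.Nat.Base using (suc; _+_; _*_; _∸_)
open import Data.Nat.ListAction using (sum)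
open import Data.Nat.ListAction.Properties using (sum-++; sum-↭)
open import Data.Nat.Solver using (module +-*-Solver)
open +-*-Solver using (solve; con; _:+_; _:*_; _:=_)
open import Data.Product.Base using (_×_; _,_; proj₁; proj₂)
open import Data.Sum.Base using (_⊎_; inj₁; inj₂)
open import Data.Sum.Properties using (inj₁-injective; inj₂-injective)
open import Function.Bundles using (module Equivalence)
open import Level using (0ℓ)
open import Relation.Binary.Bundles using (DecTotalOrder)
open import Relation.Binary.Core using (Rel)
open import Relation.Binary.Structures using (IsDecTotalOrder)
import Relation.Binary.Construct.Flip.EqAndOrd as Flip
open import Relation.Binary.PropositionalEquality
  using (_≡_; _≢_; refl; sym; trans; cong; cong₂; subst; subst₂; module ≡-Reasoning)
open import Relation.Nullary using (yes; no; contradiction)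
open import Relation.Unary using (Pred)

-- One occurrence of `x` is cut out of `ys`; the rest of `xs` avoids `x` by uniqueness and so still
-- lies in what remains. With `ys` an image list, this turns surjectivity of a map into an
-- inequality of cardinalities.
length-⊆ : ∀ {a} {A : Set a} {xs ys : List A} → Unique xs →
  (∀ {x} → x ∈ xs → x ∈ ys) → length xs ℕ.≤ length ys
length-⊆ []           xs⊆ys = ℕ.z≤n
length-⊆ {xs = x ∷ xs} (x∉xs ∷ xs!) xs⊆ys with ∈-∃++ (xs⊆ys (here refl))
... | ys₁ , ys₂ , refl = subst (suc (length xs) ℕ.≤_) (sym eq) (ℕ.s≤s (length-⊆ xs! xs⊆))
  where
  eq : length (ys₁ ++ x ∷ ys₂) ≡ suc (length (ys₁ ++ ys₂))
  eq = trans (length-++ ys₁) (trans (ℕₚ.+-suc (length ys₁) (length ys₂))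
         (cong suc (sym (length-++ ys₁))))
  xs⊆ : ∀ {z} → z ∈ xs → z ∈ ys₁ ++ ys₂
  xs⊆ z∈ with ∈-++⁻ ys₁ (xs⊆ys (there z∈))
  ... | inj₁ z∈₁         = ∈-++⁺ˡ z∈₁
  ... | inj₂ (here refl) = contradiction refl (All.lookup x∉xs z∈)
  ... | inj₂ (there z∈₂) = ∈-++⁺ʳ ys₁ z∈₂

-- Deleting one occurrence from a list

remove : ℕ → List ℕ → List ℕ
remove x []       = []
remove x (y ∷ ys) with x ℕₚ.≟ y
... | yes _ = ys
... | no  _ = y ∷ remove x ys

remove-↭ : ∀ {x ys} → x ∈ ys → ys ↭ x ∷ remove x ys
remove-↭ {x} {y ∷ ys} x∈ with x ℕₚ.≟ y | x∈
... | yes refl | _          = ↭-refl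
... | no  x≢y  | here x≡y   = contradiction x≡y x≢y
... | no  _    | there x∈ys = ↭-trans (prep y (remove-↭ x∈ys)) (swap y x ↭-refl)

remove-All : ∀ {p} {P : Pred ℕ p} x {ys} → All P ys → All P (remove x ys)
remove-All x {[]}     []         = []
remove-All x {y ∷ ys} (py ∷ pys) with x ℕₚ.≟ y
... | yes _ = pys
... | no  _ = py ∷ remove-All x pys

remove-AllPairs : ∀ {r} {R : Rel ℕ r} x {ys} → AllPairs R ys → AllPairs R (remove x ys)
remove-AllPairs x {[]}     []         = []
remove-AllPairs x {y ∷ ys} (ry ∷ rys) with x ℕₚ.≟ y
... | yes _ = rys
... | no  _ = remove-All x ry ∷ remove-AllPairs x rys

AllPairs-∷ʳ⁻ : ∀ {r} {R : Rel ℕ r} xs {y} → AllPairs R (xs ++ [ y ]) →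
  AllPairs R xs × All (λ x → R x y) xs
AllPairs-∷ʳ⁻ []       _          = [] , []
AllPairs-∷ʳ⁻ (x ∷ xs) (rx ∷ rxs) with Allₚ.++⁻ xs rx | AllPairs-∷ʳ⁻ xs rxs
... | rx′ , rxy ∷ [] | rxs′ , rxsy = rx′ ∷ rxs′ , rxy ∷ rxsy

-- Insertion and deletion in sorted lists

module Sorted {_⊑_ : Rel ℕ 0ℓ} (isDecTotalOrder : IsDecTotalOrder _≡_ _⊑_) where

  private
    order : DecTotalOrder 0ℓ 0ℓ 0ℓ
    order = record { isDecTotalOrder = isDecTotalOrder }
    open DecTotalOrder order using (totalOrder) renaming (trans to ⊑-trans)

  open InsertionSort order public using (insert)
  open InsertionSortₚ order public using (insert-↭)

  insert-AllPairs : ∀ x {ys} → AllPairs _⊑_ ys → AllPairs _⊑_ (insert x ys)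
  insert-AllPairs x ys↗ =
    Linked⇒AllPairs ⊑-trans (InsertionSortₚ.insert-↗ order x (AllPairs⇒Linked ys↗))

  -- Lets both round trips of `insert` and `remove` be checked on multisets alone, without following
  -- the position of the inserted entry.
  sorted-unique : ∀ {xs ys} → AllPairs _⊑_ xs → AllPairs _⊑_ ys → xs ↭ ys → xs ≡ ys
  sorted-unique xs↗ ys↗ xs↭ys = Pointwise.Pointwise-≡⇒≡
    (↗↭↗⇒≋ totalOrder (AllPairs⇒Linked xs↗) (AllPairs⇒Linked ys↗) (↭⇒↭ₛ xs↭ys))

  ∈-insert : ∀ x ys → x ∈ insert x ys
  ∈-insert x ys = ∈-resp-↭ (↭-sym (insert-↭ x ys)) (here refl)

  remove-insert : ∀ x {ys} → AllPairs _⊑_ ys → remove x (insert x ys) ≡ ys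
  remove-insert x {ys} ys↗ = sorted-unique
    (remove-AllPairs x (insert-AllPairs x ys↗)) ys↗
    (drop-∷ (↭-trans (↭-sym (remove-↭ (∈-insert x ys))) (insert-↭ x ys)))

  insert-remove : ∀ {x ys} → x ∈ ys → AllPairs _⊑_ ys → insert x (remove x ys) ≡ ys
  insert-remove {x} {ys} x∈ys ys↗ = sorted-unique
    (insert-AllPairs x (remove-AllPairs x ys↗)) ys↗
    (↭-trans (insert-↭ x (remove x ys)) (↭-sym (remove-↭ x∈ys)))

module Asc  = Sorted ℕₚ.≤-isDecTotalOrder
module Desc = Sorted (Flip.isDecTotalOrder ℕₚ.≤-isDecTotalOrder)

-- Unimodal sequences by components

record Unimodal (n : ℕ) (s : MarkedSeq) : Set where
  constructor unimodal
  left  = proj₁ s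
  peak  = proj₁ (proj₂ s)
  right = proj₂ (proj₂ s)
  field
    left-pos   : All (1 ℕ.≤_) left
    peak-pos   : 1 ℕ.≤ peak
    right-pos  : All (1 ℕ.≤_) right
    left-≤     : All (ℕ._≤ peak) left
    right-≤    : All (ℕ._≤ peak) right
    -- `AllPairs` instead of `Linked`: a relation between all pairs passes directly to a list with
    -- one entry deleted.
    left-asc   : AllPairs ℕ._≤_ left
    right-desc : AllPairs ℕ._≥_ right
    size       : sum left + (peak + sum right) ≡ n

to-Unimodal : ∀ {n} s → IsUnimodal n s → Unimodal n s
to-Unimodal (as , c , bs) (pos , asc , desc , size)
  with Allₚ.++⁻ as pos
     | AllPairs-∷ʳ⁻ as (Linked⇒AllPairs ℕₚ.≤-trans asc)
     | Linked⇒AllPairs (λ p q → ℕₚ.≤-trans q p) desc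
... | pas , pc ∷ pbs | as↗ , as≤ | bs≤ ∷ bs↘ =
  unimodal pas pc pbs as≤ bs≤ as↗ bs↘ (trans (sym (sum-++ as (c ∷ bs))) size)

from-Unimodal : ∀ {n} s → Unimodal n s → IsUnimodal n s
from-Unimodal (as , c , bs) (unimodal pas pc pbs as≤ bs≤ as↗ bs↘ size) =
  Allₚ.++⁺ pas (pc ∷ pbs) ,
  AllPairs⇒Linked (AllPairsₚ.++⁺ as↗ ([] ∷ []) (All.map (λ a≤c → a≤c ∷ []) as≤)) ,
  AllPairs⇒Linked (bs≤ ∷ bs↘) ,
  trans (sum-++ as (c ∷ bs)) size

∈-unimodals⁺ : ∀ {n} s → Unimodal n s → s ∈ unimodals n
∈-unimodals⁺ {n} s p = Equivalence.from (∈-unimodals n s) (from-Unimodal s p)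

∈-unimodals⁻ : ∀ {n} s → s ∈ unimodals n → Unimodal n s
∈-unimodals⁻ {n} s p = to-Unimodal s (Equivalence.to (∈-unimodals n s) p)

-- Operations that change the size by a given amount

module _ {j : ℕ} (1≤j : 1 ℕ.≤ j) where

  insert-left : ∀ {m as c bs} → j ℕ.≤ c →
    Unimodal m (as , c , bs) → Unimodal (j + m) (Asc.insert j as , c , bs)
  insert-left {as = as} {c} {bs} j≤c (unimodal pas pc pbs as≤ bs≤ as↗ bs↘ refl) =
    unimodal (All-resp-↭ perm (1≤j ∷ pas)) pc pbs (All-resp-↭ perm (j≤c ∷ as≤)) bs≤
      (Asc.insert-AllPairs j as↗) bs↘
      (trans (cong (_+ (c + sum bs)) (sum-↭ (Asc.insert-↭ j as)))
             (ℕₚ.+-assoc j (sum as) (c + sum bs)))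
    where perm = ↭-sym (Asc.insert-↭ j as)

  insert-right : ∀ {m as c bs} → j ℕ.≤ c →
    Unimodal m (as , c , bs) → Unimodal (j + m) (as , c , Desc.insert j bs)
  insert-right {as = as} {c} {bs} j≤c (unimodal pas pc pbs as≤ bs≤ as↗ bs↘ refl) =
    unimodal pas pc (All-resp-↭ perm (1≤j ∷ pbs)) as≤ (All-resp-↭ perm (j≤c ∷ bs≤))
      as↗ (Desc.insert-AllPairs j bs↘)
      (trans (cong (λ t → sum as + (c + t)) (sum-↭ (Desc.insert-↭ j bs)))
             (solve 4 (λ a c j b → a :+ (c :+ (j :+ b)) := j :+ (a :+ (c :+ b)))
                refl (sum as) c j (sum bs)))
    where
    perm = ↭-sym (Desc.insert-↭ j bs)

raise-peak : ∀ {j m as c bs} →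
  Unimodal m (as , c , bs) → Unimodal (j + m) (as , c + j , bs)
raise-peak {j} {as = as} {c} {bs} (unimodal pas pc pbs as≤ bs≤ as↗ bs↘ refl) =
  unimodal pas (ℕₚ.≤-trans pc (ℕₚ.m≤m+n c j)) pbs (All.map weaken as≤) (All.map weaken bs≤)
    as↗ bs↘
    (solve 4 (λ a c j b → a :+ (c :+ j :+ b) := j :+ (a :+ (c :+ b)))
       refl (sum as) c j (sum bs))
  where
  weaken : ∀ {x} → x ℕ.≤ c → x ℕ.≤ c + j
  weaken x≤c = ℕₚ.≤-trans x≤c (ℕₚ.m≤m+n c j)

remove-left : ∀ {j m as c bs} → j ∈ as →
  Unimodal (j + m) (as , c , bs) → Unimodal m (remove j as , c , bs)
remove-left {j} {m} {as} {c} {bs} j∈as (unimodal pas pc pbs as≤ bs≤ as↗ bs↘ size) =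
  unimodal (remove-All j pas) pc pbs (remove-All j as≤) bs≤ (remove-AllPairs j as↗) bs↘
    (ℕₚ.+-cancelˡ-≡ j _ _ (trans (sym (ℕₚ.+-assoc j (sum (remove j as)) (c + sum bs)))
      (trans (cong (_+ (c + sum bs)) (sym (sum-↭ (remove-↭ j∈as)))) size)))

-- Serves for peaks below `j`, under which `j` itself does not fit: ones fit under any positive
-- peak.
prepend-ones : ∀ i {m as c bs} →
  Unimodal m (as , c , bs) → Unimodal (i + m) (replicate i 1 ++ as , c , bs)
prepend-ones ℕ.zero  p = p
prepend-ones (suc i) p with prepend-ones i p
... | unimodal pas pc pbs as≤ bs≤ as↗ bs↘ size =
  -- Positivity `pas` of the left entries doubles as the sortedness condition for a 1 placed in
  -- front.
  unimodal (ℕₚ.≤-refl ∷ pas) pc pbs (pc ∷ as≤) bs≤ (pas ∷ as↗) bs↘ (cong suc size)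

drop-replicate-++ : ∀ {a} {A : Set a} i {x : A} xs → drop i (replicate i x ++ xs) ≡ xs
drop-replicate-++ ℕ.zero  xs = refl
drop-replicate-++ (suc i) xs = drop-replicate-++ i xs

single-Unimodal : ∀ {n} → 1 ℕ.≤ n → Unimodal n ([] , n , [])
single-Unimodal 1≤n = unimodal [] 1≤n [] [] [] [] [] (ℕₚ.+-identityʳ _)

-- The collapsing map

module _ (j n : ℕ) where

  -- Designed as a left inverse: each branch undoes one of the constructions of the covering
  -- argument, and `nothing` is the extra point. On other inputs the value is arbitrary and need not
  -- be unimodal, since only surjectivity onto the targets is claimed.
  collapse : MarkedSeq ⊎ MarkedSeq → Maybe (MarkedSeq ⊎ MarkedSeq)
  collapse (inj₂ (as , c , bs)) = just (inj₂ (Asc.insert j as , c , bs))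
  collapse (inj₁ (as , c , bs)) with j ℕₚ.≤? c
  ... | no  _ = just (inj₁ (drop j as , c , bs))
  ... | yes _ with j ∈? as
  ...   | yes _ = just (inj₁ (remove j as , c , bs))
  ...   | no  _ with j ∈? bs
  ...     | yes _ = just (inj₂ (as , c , remove j bs))
  -- In a sequence of size `n` a peak equal to `n` leaves no room for other positive entries, so
  -- this test singles out the one-term sequence.
  ...     | no  _ with c ℕₚ.≟ n
  ...       | yes _ = nothing
  ...       | no  _ = just (inj₂ (as , c ∸ j , bs))

  collapse-drop : ∀ {as c bs} → c ℕ.< j →
    collapse (inj₁ (as , c , bs)) ≡ just (inj₁ (drop j as , c , bs))
  collapse-drop {c = c} c<j with j ℕₚ.≤? c
  ... | yes j≤c = contradiction j≤c (ℕₚ.<⇒≱ c<j)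
  ... | no  _   = refl

  collapse-left : ∀ {as c bs} → j ℕ.≤ c → j ∈ as →
    collapse (inj₁ (as , c , bs)) ≡ just (inj₁ (remove j as , c , bs))
  collapse-left {as} {c} j≤c j∈as with j ℕₚ.≤? c
  ... | no  j≰c = contradiction j≤c j≰c
  ... | yes _ with j ∈? as
  ...   | yes _    = refl
  ...   | no  j∉as = contradiction j∈as j∉as

  collapse-right : ∀ {as c bs} → j ℕ.≤ c → j ∉ as → j ∈ bs →
    collapse (inj₁ (as , c , bs)) ≡ just (inj₂ (as , c , remove j bs))
  collapse-right {as} {c} {bs} j≤c j∉as j∈bs with j ℕₚ.≤? c
  ... | no  j≰c = contradiction j≤c j≰c
  ... | yes _ with j ∈? as
  ...   | yes j∈as = contradiction j∈as j∉as
  ...   | no  _ with j ∈? bs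
  ...     | yes _    = refl
  ...     | no  j∉bs = contradiction j∈bs j∉bs

  collapse-peak : ∀ {as c bs} → j ℕ.≤ c → j ∉ as → j ∉ bs → c ≢ n →
    collapse (inj₁ (as , c , bs)) ≡ just (inj₂ (as , c ∸ j , bs))
  collapse-peak {as} {c} {bs} j≤c j∉as j∉bs c≢n with j ℕₚ.≤? c
  ... | no  j≰c = contradiction j≤c j≰c
  ... | yes _ with j ∈? as
  ...   | yes j∈as = contradiction j∈as j∉as
  ...   | no  _ with j ∈? bs
  ...     | yes j∈bs = contradiction j∈bs j∉bs
  ...     | no  _ with c ℕₚ.≟ n
  ...       | yes c≡n = contradiction c≡n c≢n
  ...       | no  _   = refl

  collapse-single : j ℕ.≤ n → collapse (inj₁ ([] , n , [])) ≡ nothing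
  collapse-single j≤n with j ℕₚ.≤? n
  ... | no  j≰n = contradiction j≤n j≰n
  -- Both membership tests in `[]` have already reduced to `no`; only the peak test is left.
  ... | yes _ with n ℕₚ.≟ n
  ...   | yes _   = refl
  ...   | no  n≢n = contradiction refl n≢n

-- Disjoint unions as lists

tagged : ∀ {a} {A : Set a} → List A → List A → List (A ⊎ A)
tagged xs ys = map inj₁ xs ++ map inj₂ ys

length-tagged : ∀ {a} {A : Set a} (xs ys : List A) →
  length (tagged xs ys) ≡ length xs + length ys
length-tagged xs ys =
  trans (length-++ (map inj₁ xs)) (cong₂ _+_ (length-map inj₁ xs) (length-map inj₂ ys))

tagged-unique : ∀ {a} {A : Set a} {xs ys : List A} →
  Unique xs → Unique ys → Unique (tagged xs ys)
tagged-unique {xs = xs} {ys} xs! ys! =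
  Uniqueₚ.++⁺ (Uniqueₚ.map⁺ inj₁-injective xs!) (Uniqueₚ.map⁺ inj₂-injective ys!) disjoint
  where
  disjoint : ∀ {z} → z ∈ map inj₁ xs × z ∈ map inj₂ ys → _
  disjoint (z∈₁ , z∈₂) with ∈-map⁻ inj₁ z∈₁ | ∈-map⁻ inj₂ z∈₂
  ... | _ , _ , refl | _ , _ , ()

∉-bounded : ∀ {j c xs} → c ℕ.< j → All (ℕ._≤ c) xs → j ∉ xs
∉-bounded c<j xs≤c j∈xs = ℕₚ.<⇒≱ c<j (All.lookup xs≤c j∈xs)

-- Surjectivity of the collapsing map, with `k` in the role of n - 2j

module _ (j k : ℕ) (1≤j : 1 ℕ.≤ j) where

  private
    n : ℕ
    n = j + (j + k)

    sources : List (MarkedSeq ⊎ MarkedSeq)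
    sources = tagged (unimodals n) (unimodals k)

    targets : List (Maybe (MarkedSeq ⊎ MarkedSeq))
    targets = nothing ∷ map just (tagged (unimodals (j + k)) (unimodals (j + k)))

    targets-unique : Unique targets
    targets-unique = Allₚ.map⁺ (All.tabulate λ _ ()) ∷
      Uniqueₚ.map⁺ just-injective
        (tagged-unique (unimodals-unique (j + k)) (unimodals-unique (j + k)))

    image : List (Maybe (MarkedSeq ⊎ MarkedSeq))
    image = map (collapse j n) sources

    image₁ : ∀ s {t} → Unimodal n s → collapse j n (inj₁ s) ≡ t → t ∈ image
    image₁ s p refl = ∈-map⁺ (collapse j n) (∈-++⁺ˡ (∈-map⁺ inj₁ (∈-unimodals⁺ s p)))

    image₂ : ∀ s {t} → Unimodal k s → collapse j n (inj₂ s) ≡ t → t ∈ image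
    image₂ s p refl = ∈-map⁺ (collapse j n)
      (∈-++⁺ʳ (map inj₁ (unimodals n)) (∈-map⁺ inj₂ (∈-unimodals⁺ s p)))

    nothing-covered : nothing ∈ image
    nothing-covered = image₁ ([] , n , [])
      (single-Unimodal (ℕₚ.≤-trans 1≤j (ℕₚ.m≤m+n j (j + k))))
      (collapse-single j n (ℕₚ.m≤m+n j (j + k)))

    -- Both preimages keep the peak `c`, so `collapse` repeats the same comparison of `j` with `c`
    -- and undoes the matching construction.
    first-covered : ∀ s → Unimodal (j + k) s → just (inj₁ s) ∈ image
    first-covered (as , c , bs) p with j ℕₚ.≤? c
    ... | yes j≤c = image₁ (Asc.insert j as , c , bs) (insert-left 1≤j j≤c p)
      (trans (collapse-left j n j≤c (Asc.∈-insert j as))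
        (cong (λ as′ → just (inj₁ (as′ , c , bs))) (Asc.remove-insert j (Unimodal.left-asc p))))
    ... | no  j≰c = image₁ (replicate j 1 ++ as , c , bs) (prepend-ones j p)
      (trans (collapse-drop j n (ℕₚ.≰⇒> j≰c))
        (cong (λ as′ → just (inj₁ (as′ , c , bs))) (drop-replicate-++ j as)))

    -- The raised peak is below `j + j`, hence below `n`, so a raised sequence is never sent to
    -- `nothing`.
    raised≢n : ∀ {c} → c ℕ.< j → c + j ≢ n
    raised≢n c<j = ℕₚ.<⇒≢ (ℕₚ.+-mono-<-≤ c<j (ℕₚ.m≤m+n j k))

    second-covered : ∀ s → Unimodal (j + k) s → just (inj₂ s) ∈ image
    second-covered (as , c , bs) p with j ℕₚ.≤? c
    -- All side entries are at most `c < j`, so `j` is on neither side, while the new peak is at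
    -- least `j`: `collapse` reaches its last branch.
    ... | no  j≰c = image₁ (as , c + j , bs) (raise-peak p)
      (trans (collapse-peak j n (ℕₚ.m≤n+m j c)
               (∉-bounded c<j (Unimodal.left-≤ p)) (∉-bounded c<j (Unimodal.right-≤ p))
               (raised≢n c<j))
        (cong (λ c′ → just (inj₂ (as , c′ , bs))) (ℕₚ.m+n∸n≡m c j)))
      where c<j = ℕₚ.≰⇒> j≰c
    ... | yes j≤c with j ∈? as
    -- Inserting `j` on the right would fail here, because `collapse` looks on the left first and
    -- would delete that `j`. The preimage is therefore taken among the sequences of size `k`.
    ...   | yes j∈as = image₂ (remove j as , c , bs) (remove-left j∈as p)
      (cong (λ as′ → just (inj₂ (as′ , c , bs))) (Asc.insert-remove j∈as (Unimodal.left-asc p)))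
    ...   | no  j∉as = image₁ (as , c , Desc.insert j bs) (insert-right 1≤j j≤c p)
      (trans (collapse-right j n j≤c j∉as (Desc.∈-insert j bs))
        (cong (λ bs′ → just (inj₂ (as , c , bs′))) (Desc.remove-insert j (Unimodal.right-desc p))))

    targets⊆image : ∀ {t} → t ∈ targets → t ∈ image
    targets⊆image (here refl) = nothing-covered
    targets⊆image (there t∈)  with ∈-map⁻ just t∈
    ... | x , x∈ , refl with ∈-++⁻ (map inj₁ (unimodals (j + k))) x∈
    ...   | inj₁ x∈₁ with ∈-map⁻ inj₁ x∈₁
    ...     | s , s∈ , refl = first-covered s (∈-unimodals⁻ s s∈)
    targets⊆image (there t∈) | x , x∈ , refl | inj₂ x∈₂ with ∈-map⁻ inj₂ x∈₂
    ...     | s , s∈ , refl = second-covered s (∈-unimodals⁻ s s∈)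

  unimodals-convex : length (unimodals (j + k)) + length (unimodals (j + k)) ℕ.<
    length (unimodals (j + (j + k))) + length (unimodals k)
  unimodals-convex = subst₂ ℕ._≤_
    -- The strict inequality unfolds to `suc _ ≤ _`, and this `suc` counts the entry `nothing` of
    -- `targets`.
    (cong suc (trans (length-map just (tagged A A)) (length-tagged A A)))
    (trans (length-map (collapse j n) sources) (length-tagged (unimodals n) (unimodals k)))
    (length-⊆ targets-unique targets⊆image)
    where A = unimodals (j + k)

u≡length : ∀ {n} → 1 ℕ.≤ n → u n ≡ length (unimodals n)
u≡length (ℕ.s≤s _) = refl

-- `u` is the length of the list at positive sizes, whereas `u 0` is 1 and `unimodals 0` is empty;
-- `1 ≤ k` keeps all three sizes positive.
u-convex : ∀ j k → 1 ℕ.≤ j → 1 ℕ.≤ k → u (j + k) + u (j + k) ℕ.< u (j + (j + k)) + u k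
u-convex j k 1≤j 1≤k
  rewrite u≡length 1≤k
        | u≡length (ℕₚ.≤-trans 1≤j (ℕₚ.m≤m+n j k))
        | u≡length (ℕₚ.≤-trans 1≤j (ℕₚ.m≤m+n j (j + k)))
  = unimodals-convex j k 1≤j

-- Passage to the integers

pos-∸ : ∀ m n → ℤ.+ (n + m) ℤ.- ℤ.+ n ≡ ℤ.+ m
pos-∸ m n = trans (ℤₚ.m-n≡m⊖n (n + m) n)
  (trans (ℤₚ.⊖-≥ (ℕₚ.m≤m+n n m)) (cong ℤ.+_ (ℕₚ.m+n∸m≡n n m)))

-- The gap in the hypothesis gets a name: `a + c` is `2 * b + suc d`, so the expression, rearranged
-- to a + c - 2b, equals `suc d`.
second-difference-pos : ∀ {a b c} → b + b ℕ.< a + c →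
  (ℤ.+ a ℤ.- ℤ.+ 2 ℤ.* ℤ.+ b ℤ.+ ℤ.+ c) > 0ℤ
second-difference-pos {a} {b} {c} b+b<a+c with ℕₚ.m≤n⇒∃[o]m+o≡n b+b<a+c
... | d , eq = subst (_> 0ℤ) (sym value) (ℤ.+<+ (ℕ.s≤s ℕ.z≤n))
  where
  open ≡-Reasoning
  value : ℤ.+ a ℤ.- ℤ.+ 2 ℤ.* ℤ.+ b ℤ.+ ℤ.+ c ≡ ℤ.+ suc d
  value = begin
    ℤ.+ a ℤ.- ℤ.+ 2 ℤ.* ℤ.+ b ℤ.+ ℤ.+ c
      ≡⟨ cong (λ t → ℤ.+ a ℤ.- t ℤ.+ ℤ.+ c) (sym (ℤₚ.pos-* 2 b)) ⟩
    ℤ.+ a ℤ.- ℤ.+ (2 * b) ℤ.+ ℤ.+ c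
      ≡⟨ ℤₚ.+-assoc (ℤ.+ a) (ℤ.- ℤ.+ (2 * b)) (ℤ.+ c) ⟩
    ℤ.+ a ℤ.+ (ℤ.- ℤ.+ (2 * b) ℤ.+ ℤ.+ c)
      ≡⟨ cong (λ t → ℤ.+ a ℤ.+ t) (ℤₚ.+-comm (ℤ.- ℤ.+ (2 * b)) (ℤ.+ c)) ⟩
    ℤ.+ a ℤ.+ (ℤ.+ c ℤ.- ℤ.+ (2 * b))
      ≡⟨ sym (ℤₚ.+-assoc (ℤ.+ a) (ℤ.+ c) (ℤ.- ℤ.+ (2 * b))) ⟩
    ℤ.+ (a + c) ℤ.- ℤ.+ (2 * b)
      ≡⟨ cong (λ t → ℤ.+ t ℤ.- ℤ.+ (2 * b)) (trans (sym eq)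
           (solve 2 (λ b d → con 1 :+ (b :+ b) :+ d := con 2 :* b :+ (con 1 :+ d)) refl b d)) ⟩
    ℤ.+ (2 * b + suc d) ℤ.- ℤ.+ (2 * b)
      ≡⟨ pos-∸ (suc d) (2 * b) ⟩
    ℤ.+ suc d ∎

uℤ-convex : ∀ j k → 1 ℕ.≤ j → 1 ℕ.≤ k → Δ²[ j ] uℤ (ℤ.+ (j + (j + k))) > 0ℤ
uℤ-convex j k 1≤j 1≤k
  -- The shifted arguments become `j + k` and `k`, both in the form `+ _`, where `uℤ` reduces to
  -- `u`.
  rewrite pos-∸ (j + k) j
        | trans (cong (λ t → ℤ.+ t ℤ.- ℤ.+ (2 * j))
            (solve 2 (λ j k → j :+ (j :+ k) := con 2 :* j :+ k) refl j k)) (pos-∸ k (2 * j))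
  = second-difference-pos {u (j + (j + k))} {u (j + k)} {u k} (u-convex j k 1≤j 1≤k)

theorem1p3 : ∀ (j : ℕ) → 1 ℕ.≤ j →
    Σ[ nΔ ∈ ℤ ] (∀ (n : ℤ) → nΔ ≤ n → Δ²[ j ] uℤ n > 0ℤ)
theorem1p3 j 1≤j = ℤ.+ suc (j + j) , positive
  where
  positive : ∀ n → ℤ.+ suc (j + j) ≤ n → Δ²[ j ] uℤ n > 0ℤ
  positive (ℤ.+ m) (ℤ.+≤+ 2j<m) with ℕₚ.m≤n⇒∃[o]m+o≡n 2j<m
  -- Here n is 2j + 1 + d, so `k` is `suc d`: the 1 in the bound makes `k` positive.
  ... | d , refl = subst (λ t → Δ²[ j ] uℤ (ℤ.+ t) > 0ℤ)
    (solve 2 (λ j d → j :+ (j :+ (con 1 :+ d)) := con 1 :+ (j :+ j) :+ d) refl j d)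
    (uℤ-convex j (suc d) 1≤j (ℕ.s≤s ℕ.z≤n))
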